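{- Let $L=\mathcal{F}(P)$ be a finite distributive lattice and let $K$ be a cutting of $L$. Then for all $k$, $$d_k((L\boxplus K)\boxplus K)=d_k(L\boxplus K)+d_{k-2}(K)$$ and $$d_k^-(L\boxplus K)=d_k^-(L)+d_{k-1}^-(K).$$
   Context: For a finite poset $P$, $\mathcal{F}(P)$ is the set of filters (up-sets) of $P$ ordered by reverse inclusion; every finite distributive lattice is isomorphic to some $\mathcal{F}(P)$. A cutting of a finite distributive lattice $L$ is an interval $K=[\hat0_K,\hat1_K]$ of $L$ such that every maximal chain of $L$ meets $K$. For a cutting $K$ of $L=\mathcal{F}(P)$, let $S=\hat0_K\setminus\hat1_K$, $S_0$ the set of maximal elements of $P\setminus\hat0_K$, $S_1$ the set of minimal elements of $\hat1_K$. The poset $P_K$ is $P\cup\{x_K\}$ ($x_K$ new) where the order on $P$ is unchanged, $z<x_K$ iff $z\le s$ for some $s\in S_0$, $x_K<y$ iff $y\ge s$ for some $s\in S_1$, and $x_K$ is incomparable to every element of $S$; the convex expansion is $L\boxplus K:=\mathcal{F}(P_K)$. The lattice $(L\boxplus K)\boxplus K$ is the expansion of $L\boxplus K$ by the copy of $K$ in it, namely $\mathcal{F}(P')$ where $P'=P\cup\{x_1,x_2\}$ ($x_1,x_2$ new) with the order of $P$ unchanged, $x_1<x_2$, $z<x_1$ iff $z\le s$ for some $s\in S_0$, $x_2<y$ iff $y\ge s$ for some $s\in S_1$ (and then $z<x_2$, $x_1<y$ accordingly), and $x_1,x_2$ incomparable to every element of $S$. For a finite lattice $M$ and $a\in M$: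 $\deg^-_M(a)$ is the number of elements covering $a$, $\deg^+_M(a)$ the number of elements covered by $a$, $\deg_M(a)=\deg^-_M(a)+\deg^+_M(a)$; $d_k^-(M)$ (resp. $d_k(M)$) is the number of $a\in M$ with $\deg^-_M(a)=k$ (resp. $\deg_M(a)=k$), and these are $0$ for negative $k$. -}

module Defs where

open import Data.Bool.Properties using () renaming (_≟_ to _≟ᵇ_)
open import Data.Empty using (⊥; ⊥-elim)
open import Data.Fin using (Fin; zero; suc)
import Data.Fin.Properties as Fin
open import Data.Fin.Subset using (Subset; inside; outside; _∈_; _∉_; _⊆_; _⊂_)
open import Data.Fin.Subset.Properties using (_∈?_; _⊆?_; _⊂?_; anySubset?; ⊆-refl)
open import Data.Integer using (ℤ; +_)
import Data.Integer.Properties as ℤ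
open import Data.List using (List; []; _∷_; [_]; map; _++_; filter; length)
open import Data.List.Membership.Propositional using () renaming (_∈_ to _∈ˡ_)
open import Data.List.Membership.Propositional.Properties using (∈-map⁺; ∈-++⁺ˡ; ∈-++⁺ʳ)
import Data.List.Relation.Unary.All as All
open import Data.List.Relation.Unary.Any using (here; there; any?)
open import Data.Nat using (ℕ; zero; suc; _+_)
open import Data.Product using (∃; _×_; _,_)
open import Data.Sum using (_⊎_; inj₁; inj₂; swap)
open import Data.Unit using (⊤; tt)
open import Data.Vec using ([]; _∷_; tabulate)
open import Data.Vec.Properties using (≡-dec; lookup∘tabulate; []=⇒lookup; lookup⇒[]=)
open import Level using (0ℓ)
open import Relation.Binary using (Rel; IsDecPartialOrder)
import Relation.Binary as B
open import Relation.Binary.PropositionalEquality using (_≡_; refl; sym; trans; cong; isEquivalence)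
open import Relation.Nullary using (¬_; yes; no; does)
open import Relation.Nullary.Decidable using (_×-dec_; _⊎-dec_; _→-dec_; ¬?; decidable-stable; dec-true; dec-false)
open import Relation.Unary using (Pred; Decidable)

record FinPoset (n : ℕ) : Set₁ where
  infix 4 _≤_
  field
    _≤_               : Rel (Fin n) 0ℓ
    isDecPartialOrder : IsDecPartialOrder _≡_ _≤_

  open IsDecPartialOrder isDecPartialOrder public
    using (_≤?_; antisym) renaming (refl to ≤-refl; trans to ≤-trans)

------------------------------------------------------------------------
-- Finite families of subsets of Fin n, ordered by reverse inclusion.
-- F(P) and its intervals are lattices of this kind, so the degree
-- statistics below are defined for such families.

infix 4 _⊑_ _⊏_

_⊑_ : ∀ {n} → Rel (Subset n) 0ℓ
a ⊑ b = b ⊆ a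

_⊏_ : ∀ {n} → Rel (Subset n) 0ℓ
a ⊏ b = b ⊂ a

record Family (n : ℕ) : Set₁ where
  field
    Mem  : Pred (Subset n) 0ℓ
    mem? : Decidable Mem

open Family public

subsets : ∀ n → List (Subset n)
subsets zero    = [ [] ]
subsets (suc n) = map (inside ∷_) (subsets n) ++ map (outside ∷_) (subsets n)

∈-subsets : ∀ {n} (a : Subset n) → a ∈ˡ subsets n
∈-subsets []                = here refl
∈-subsets (inside  ∷ a)     = ∈-++⁺ˡ (∈-map⁺ (inside ∷_) (∈-subsets a))
∈-subsets {suc n} (outside ∷ a) =
  ∈-++⁺ʳ (map (inside ∷_) (subsets n)) (∈-map⁺ (outside ∷_) (∈-subsets a))

count : ∀ {n} {Q : Pred (Subset n) 0ℓ} → Decidable Q → ℕ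
count {n} Q? = length (filter Q? (subsets n))

module _ {n : ℕ} (M : Family n) where

  -- Covers a b: b covers a in M.
  Covers : Rel (Subset n) 0ℓ
  Covers a b = Mem M a × Mem M b × a ⊏ b × ¬ ∃ λ c → Mem M c × a ⊏ c × c ⊏ b

  covers? : B.Decidable Covers
  covers? a b = mem? M a ×-dec mem? M b ×-dec (b ⊂? a) ×-dec
    ¬? (anySubset? λ c → mem? M c ×-dec (c ⊂? a) ×-dec (b ⊂? c))

  deg⁻ : Subset n → ℕ
  deg⁻ a = count λ b → covers? a b

  deg⁺ : Subset n → ℕ
  deg⁺ a = count λ b → covers? b a

  deg : Subset n → ℕ
  deg a = deg⁻ a + deg⁺ a

  d⁻ : ℤ → ℕ
  d⁻ k = count λ a → mem? M a ×-dec (+ deg⁻ a ℤ.≟ k)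

  d : ℤ → ℕ
  d k = count λ a → mem? M a ×-dec (+ deg a ℤ.≟ k)

  Comparable : Rel (Subset n) 0ℓ
  Comparable a b = a ⊑ b ⊎ b ⊑ a

  IsChain : Family n → Set
  IsChain C = (∀ {a} → Mem C a → Mem M a) ×
              (∀ {a b} → Mem C a → Mem C b → Comparable a b)

  IsMaximalChain : Family n → Set₁
  IsMaximalChain C = IsChain C ×
    (∀ D → IsChain D → (∀ {a} → Mem C a → Mem D a) → ∀ {a} → Mem D a → Mem C a)

module _ {n : ℕ} (P : FinPoset n) where
  open FinPoset P

  IsFilter : Pred (Subset n) 0ℓ
  IsFilter a = ∀ x y → x ≤ y → x ∈ a → y ∈ a

  isFilter? : Decidable IsFilter
  isFilter? a = Fin.all? λ x → Fin.all? λ y → (x ≤? y) →-dec ((x ∈? a) →-dec (y ∈? a))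

  𝓕 : Family n
  𝓕 = record { Mem = IsFilter ; mem? = isFilter? }

[_⋯_]in : ∀ {n} → Subset n → Subset n → Family n → Family n
[ l ⋯ u ]in M = record
  { Mem  = λ a → Mem M a × l ⊑ a × a ⊑ u
  ; mem? = λ a → mem? M a ×-dec (a ⊆? l) ×-dec (u ⊆? a)
  }

record Cutting {n : ℕ} (P : FinPoset n) : Set₁ where
  field
    0̂      : Subset n
    1̂      : Subset n
    0̂∈𝓕    : Mem (𝓕 P) 0̂
    1̂∈𝓕    : Mem (𝓕 P) 1̂
    0̂⊑1̂    : 0̂ ⊑ 1̂

  interval : Family n
  interval = [ 0̂ ⋯ 1̂ ]in (𝓕 P)

  field
    meets : ∀ C → IsMaximalChain (𝓕 P) C → ∃ λ a → Mem C a × Mem interval a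

------------------------------------------------------------------------
-- Every filter lies on a maximal chain; needed to see that the expanded
-- orders below are transitive.

module _ {n : ℕ} (M : Family n) where

  private
    comparable? : B.Decidable (Comparable M)
    comparable? a b = (b ⊆? a) ⊎-dec (a ⊆? b)

    IsChainˡ : List (Subset n) → Set
    IsChainˡ C = (∀ {a} → a ∈ˡ C → Mem M a) ×
                 (∀ {a b} → a ∈ˡ C → b ∈ˡ C → Comparable M a b)

    extend : ∀ xs acc → IsChainˡ acc → ∃ λ C → IsChainˡ C ×
             (∀ {a} → a ∈ˡ acc → a ∈ˡ C) ×
             (∀ {a} → a ∈ˡ xs → Mem M a → (∀ {c} → c ∈ˡ C → Comparable M a c) → a ∈ˡ C)
    extend []       acc ch = acc , ch , (λ p → p) , λ ()
    extend (x ∷ xs) acc (inM , comp)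
      with mem? M x ×-dec All.all? (comparable? x) acc
    ... | yes (x∈M , xc) =
      let C , ch , sub , mx = extend xs (x ∷ acc) (inM′ , comp′)
      in  C , ch , (λ p → sub (there p)) ,
          λ { (here refl) _ _ → sub (here refl) ; (there p) → mx p }
      where
      inM′ : ∀ {a} → a ∈ˡ (x ∷ acc) → Mem M a
      inM′ (here refl) = x∈M
      inM′ (there p)   = inM p
      comp′ : ∀ {a b} → a ∈ˡ (x ∷ acc) → b ∈ˡ (x ∷ acc) → Comparable M a b
      comp′ (here refl) (here refl) = inj₁ ⊆-refl
      comp′ (here refl) (there q)   = All.lookup xc q
      comp′ (there p)   (here refl) = swap (All.lookup xc p)
      comp′ (there p)   (there q)   = comp p q
    ... | no ¬q =
      let C , ch , sub , mx = extend xs acc (inM , comp)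
      in  C , ch , sub ,
          λ { (here refl) m c → ⊥-elim (¬q (m , All.tabulate (λ p → c (sub p))))
            ; (there p) → mx p }

  maximalChainThrough : ∀ {a} → Mem M a → ∃ λ C → IsMaximalChain M C × Mem C a
  maximalChainThrough {a} a∈M =
    let C , (inM , comp) , sub , mx =
          extend (subsets n) [ a ]
            ( (λ { (here refl) → a∈M })
            , (λ { (here refl) (here refl) → inj₁ ⊆-refl }))
    in  record { Mem = _∈ˡ C ; mem? = λ b → any? (≡-dec _≟ᵇ_ b) C }
      , ( (inM , comp)
        , λ D (DinM , Dcomp) C⊆D {b} b∈D →
            mx (∈-subsets b) (DinM b∈D) (λ c∈C → Dcomp b∈D (C⊆D c∈C)))
      , sub (here refl)

module Expansion {n : ℕ} (P : FinPoset n) (K : Cutting P) where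
  open FinPoset P
  open Cutting K

  S₀ : Pred (Fin n) 0ℓ
  S₀ s = s ∉ 0̂ × (∀ t → t ∉ 0̂ → s ≤ t → t ≡ s)

  S₁ : Pred (Fin n) 0ℓ
  S₁ s = s ∈ 1̂ × (∀ t → t ∈ 1̂ → t ≤ s → t ≡ s)

  BelowS₀ : Pred (Fin n) 0ℓ
  BelowS₀ z = ∃ λ s → S₀ s × z ≤ s

  AboveS₁ : Pred (Fin n) 0ℓ
  AboveS₁ y = ∃ λ s → S₁ s × s ≤ y

  belowS₀? : Decidable BelowS₀
  belowS₀? z = Fin.any? λ s →
    (¬? (s ∈? 0̂) ×-dec Fin.all? λ t → ¬? (t ∈? 0̂) →-dec ((s ≤? t) →-dec (t Fin.≟ s)))
    ×-dec (z ≤? s)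

  aboveS₁? : Decidable AboveS₁
  aboveS₁? y = Fin.any? λ s →
    ((s ∈? 1̂) ×-dec Fin.all? λ t → (t ∈? 1̂) →-dec ((t ≤? s) →-dec (t Fin.≟ s)))
    ×-dec (s ≤? y)

  -- By these two facts the new elements are incomparable to 0̂ ∖ 1̂.
  below⇒∉0̂ : ∀ {z} → BelowS₀ z → z ∉ 0̂
  below⇒∉0̂ (s , (s∉ , _) , z≤s) z∈ = s∉ (0̂∈𝓕 _ _ z≤s z∈)

  above⇒∈1̂ : ∀ {y} → AboveS₁ y → y ∈ 1̂
  above⇒∈1̂ (s , (s∈ , _) , s≤y) = 1̂∈𝓕 _ _ s≤y s∈

  ¬below×above : ∀ {z} → BelowS₀ z → AboveS₁ z → ⊥
  ¬below×above b a = below⇒∉0̂ b (0̂⊑1̂ (above⇒∈1̂ a))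

  down-below : ∀ {y z} → y ≤ z → BelowS₀ z → BelowS₀ y
  down-below y≤z (s , s∈ , z≤s) = s , s∈ , ≤-trans y≤z z≤s

  up-above : ∀ {y z} → y ≤ z → AboveS₁ y → AboveS₁ z
  up-above y≤z (s , s∈ , s≤y) = s , s∈ , ≤-trans s≤y y≤z

  -- If z ≰ y, a maximal chain through the filter { w | w ≰ y } misses K.
  below-above : ∀ {z y} → BelowS₀ z → AboveS₁ y → z ≤ y
  below-above {z} {y} z↓ y↑ = decidable-stable (z ≤? y) absurd
    where
    G : Subset n
    G = tabulate λ w → does (¬? (w ≤? y))

    ∈G⁺ : ∀ {w} → ¬ w ≤ y → w ∈ G
    ∈G⁺ {w} w≰y = lookup⇒[]= w G
      (trans (lookup∘tabulate _ w) (dec-true (¬? (w ≤? y)) w≰y))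

    ∈G⁻ : ∀ {w} → w ∈ G → ¬ w ≤ y
    ∈G⁻ {w} w∈G w≤y
      with () ← trans (sym (dec-false (¬? (w ≤? y)) (λ w≰y → w≰y w≤y)))
                      (trans (sym (lookup∘tabulate _ w)) ([]=⇒lookup w∈G))

    G∈𝓕 : IsFilter P G
    G∈𝓕 v w v≤w v∈G = ∈G⁺ λ w≤y → ∈G⁻ v∈G (≤-trans v≤w w≤y)

    absurd : ¬ ¬ z ≤ y
    absurd z≰y with maximalChainThrough (𝓕 P) G∈𝓕
    ... | C , max@((_ , comp) , _) , G∈C with meets C max
    ...   | a , a∈C , _ , a⊆0̂ , 1̂⊆a with comp a∈C G∈C
    ...     | inj₁ G⊆a = below⇒∉0̂ z↓ (a⊆0̂ (G⊆a (∈G⁺ z≰y)))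
    ...     | inj₂ a⊆G = ∈G⁻ (a⊆G (1̂⊆a (above⇒∈1̂ y↑))) ≤-refl

  -- P_K on Fin (suc n): zero is x_K, and suc embeds P.
  infix 4 _≤₁_
  _≤₁_ : Rel (Fin (suc n)) 0ℓ
  zero  ≤₁ zero  = ⊤
  suc z ≤₁ zero  = BelowS₀ z
  zero  ≤₁ suc y = AboveS₁ y
  suc z ≤₁ suc y = z ≤ y

  P₁ : FinPoset (suc n)
  P₁ = record
    { _≤_ = _≤₁_
    ; isDecPartialOrder = record
      { isPartialOrder = record
        { isPreorder = record
          { isEquivalence = isEquivalence
          ; reflexive     = λ { {zero} refl → tt ; {suc _} refl → ≤-refl }
          ; trans         = λ {a} {b} {c} → trans₁ a b c
          }
        ; antisym = λ {a} {b} → antisym₁ a b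
        }
      ; _≟_  = Fin._≟_
      ; _≤?_ = dec₁
      }
    }
    where
    trans₁ : ∀ a b c → a ≤₁ b → b ≤₁ c → a ≤₁ c
    trans₁ zero    zero    _       _ q = q
    trans₁ zero    (suc b) zero    p q = tt
    trans₁ zero    (suc b) (suc c) p q = up-above q p
    trans₁ (suc a) zero    zero    p _ = p
    trans₁ (suc a) zero    (suc c) p q = below-above p q
    trans₁ (suc a) (suc b) zero    p q = down-below p q
    trans₁ (suc a) (suc b) (suc c) p q = ≤-trans p q

    antisym₁ : ∀ a b → a ≤₁ b → b ≤₁ a → a ≡ b
    antisym₁ zero    zero    _ _ = refl
    antisym₁ zero    (suc b) p q = ⊥-elim (¬below×above q p)
    antisym₁ (suc a) zero    p q = ⊥-elim (¬below×above p q)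
    antisym₁ (suc a) (suc b) p q = cong suc (antisym p q)

    dec₁ : B.Decidable _≤₁_
    dec₁ zero    zero    = yes tt
    dec₁ (suc z) zero    = belowS₀? z
    dec₁ zero    (suc y) = aboveS₁? y
    dec₁ (suc z) (suc y) = z ≤? y

  -- P′ on Fin (suc (suc n)): zero is x₁, suc zero is x₂, and
  -- suc ∘ suc embeds P.
  infix 4 _≤₂_
  _≤₂_ : Rel (Fin (suc (suc n))) 0ℓ
  zero        ≤₂ zero        = ⊤
  zero        ≤₂ suc zero    = ⊤
  suc zero    ≤₂ zero        = ⊥
  suc zero    ≤₂ suc zero    = ⊤
  suc (suc z) ≤₂ zero        = BelowS₀ z
  suc (suc z) ≤₂ suc zero    = BelowS₀ z
  zero        ≤₂ suc (suc y) = AboveS₁ y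
  suc zero    ≤₂ suc (suc y) = AboveS₁ y
  suc (suc z) ≤₂ suc (suc y) = z ≤ y

  P₂ : FinPoset (suc (suc n))
  P₂ = record
    { _≤_ = _≤₂_
    ; isDecPartialOrder = record
      { isPartialOrder = record
        { isPreorder = record
          { isEquivalence = isEquivalence
          ; reflexive     = λ { {zero} refl → tt ; {suc zero} refl → tt ; {suc (suc _)} refl → ≤-refl }
          ; trans         = λ {a} {b} {c} → trans₂ a b c
          }
        ; antisym = λ {a} {b} → antisym₂ a b
        }
      ; _≟_  = Fin._≟_
      ; _≤?_ = dec₂
      }
    }
    where
    trans₂ : ∀ a b c → a ≤₂ b → b ≤₂ c → a ≤₂ c
    trans₂ zero          zero          _             _ q = q
    trans₂ zero          (suc zero)    (suc zero)    _ _ = tt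
    trans₂ zero          (suc zero)    (suc (suc c)) _ q = q
    trans₂ zero          (suc (suc b)) zero          _ _ = tt
    trans₂ zero          (suc (suc b)) (suc zero)    _ _ = tt
    trans₂ zero          (suc (suc b)) (suc (suc c)) p q = up-above q p
    trans₂ (suc zero)    (suc zero)    _             _ q = q
    trans₂ (suc zero)    (suc (suc b)) zero          p q = ¬below×above q p
    trans₂ (suc zero)    (suc (suc b)) (suc zero)    _ _ = tt
    trans₂ (suc zero)    (suc (suc b)) (suc (suc c)) p q = up-above q p
    trans₂ (suc (suc a)) zero          zero          p _ = p
    trans₂ (suc (suc a)) zero          (suc zero)    p _ = p
    trans₂ (suc (suc a)) zero          (suc (suc c)) p q = below-above p q
    trans₂ (suc (suc a)) (suc zero)    (suc zero)    p _ = p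
    trans₂ (suc (suc a)) (suc zero)    (suc (suc c)) p q = below-above p q
    trans₂ (suc (suc a)) (suc (suc b)) zero          p q = down-below p q
    trans₂ (suc (suc a)) (suc (suc b)) (suc zero)    p q = down-below p q
    trans₂ (suc (suc a)) (suc (suc b)) (suc (suc c)) p q = ≤-trans p q

    antisym₂ : ∀ a b → a ≤₂ b → b ≤₂ a → a ≡ b
    antisym₂ zero          zero          _ _ = refl
    antisym₂ zero          (suc (suc b)) p q = ⊥-elim (¬below×above q p)
    antisym₂ (suc zero)    (suc zero)    _ _ = refl
    antisym₂ (suc zero)    (suc (suc b)) p q = ⊥-elim (¬below×above q p)
    antisym₂ (suc (suc a)) zero          p q = ⊥-elim (¬below×above p q)
    antisym₂ (suc (suc a)) (suc zero)    p q = ⊥-elim (¬below×above p q)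
    antisym₂ (suc (suc a)) (suc (suc b)) p q = cong (λ i → suc (suc i)) (antisym p q)

    dec₂ : B.Decidable _≤₂_
    dec₂ zero          zero          = yes tt
    dec₂ zero          (suc zero)    = yes tt
    dec₂ (suc zero)    zero          = no λ ()
    dec₂ (suc zero)    (suc zero)    = yes tt
    dec₂ (suc (suc z)) zero          = belowS₀? z
    dec₂ (suc (suc z)) (suc zero)    = belowS₀? z
    dec₂ zero          (suc (suc y)) = aboveS₁? y
    dec₂ (suc zero)    (suc (suc y)) = aboveS₁? y
    dec₂ (suc (suc z)) (suc (suc y)) = z ≤? y

-- P ⊞ K is the lattice F(P) ⊞ K, and P ⊞⊞ K is (F(P) ⊞ K) ⊞ K.
_⊞_ : ∀ {n} (P : FinPoset n) → Cutting P → Family (suc n)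
P ⊞ K = 𝓕 (Expansion.P₁ P K)

_⊞⊞_ : ∀ {n} (P : FinPoset n) → Cutting P → Family (suc (suc n))
P ⊞⊞ K = 𝓕 (Expansion.P₂ P K)

{-# OPTIONS --safe #-}
-- Let A be the filters of P containing 1̂ and B those contained in 0̂, so that
-- K = A ∩ B.  Recording membership of the new elements in front, the filters of
-- P_K are 1×A ∪ 0×B, and those of P′ are 11×A ∪ 01×K ∪ 00×B.  If b ⊆ a with
-- a ∈ A and b ∈ B, then a ∩ 0̂ lies in K and between b and a; hence the only
-- covers between two consecutive layers are the pairs (a , a) with a ∈ K, and
-- none skips a layer.  So a layer's degrees are those in A, K or B, plus one for
-- each adjacent layer containing the same filter.  For the second identity,
-- the cutting property says that every filter is in A or B, and by the same
-- interpolation all upper covers of an element of A ∖ B are in A.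
module Submission where

open import Data.Bool using (true; false; if_then_else_)
open import Data.Bool.Properties using () renaming (_≟_ to _≟ᵇ_)
open import Data.Empty using (⊥)
open import Data.Fin using (Fin; zero; suc)
open import Data.Fin.Induction using (po-wellFounded)
import Data.Fin.Properties as Fin
open import Data.Fin.Subset using (Subset; inside; outside; _∈_; _∉_; _⊆_; _⊂_; _∩_)
open import Data.Fin.Subset.Properties using (_∈?_; _⊆?_; drop-there; drop-∷-⊆; drop-∷-⊂; s⊆s; out⊆; s⊂s; out⊂in; ⊆-refl; ⊆-trans; ⊆-antisym; p∩q⊆p; p∩q⊆q; x∈p∩q⁺; x∈p∩q⁻)
open import Data.Integer using (ℤ; +_; _-_)
import Data.Integer as ℤ
import Data.Integer.Properties as ℤ
open import Data.List using ([]; _∷_; filter; length; map; _++_)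
open import Data.List.Properties using (filter-++; length-++; filter-≐; filter-none)
import Data.List.Relation.Unary.All as All
open import Data.Nat using (ℕ; zero; suc; _+_)
open import Data.Nat.Properties using (+-comm; +-assoc; +-identityʳ; +-suc; +-commutativeSemigroup)
open import Data.Product using (_×_; _,_; proj₁; proj₂; ∃; swap; assocˡ′; assocʳ′)
open import Data.Sum using (_⊎_; inj₁; inj₂)
open import Data.Vec using ([]; _∷_; here; there)
open import Data.Vec.Properties using (≡-dec; ∷-injectiveʳ)
open import Function using (_∘_; _$_)
open import Induction.WellFounded using (Acc; acc)
open import Level using (0ℓ)
open import Relation.Binary using (Rel; IsPartialOrder; IsDecPartialOrder)
import Relation.Binary as B
import Relation.Binary.Construct.Flip.EqAndOrd as Flip
open import Relation.Binary.PropositionalEquality using (_≡_; refl; sym; trans; cong; cong₂; subst; module ≡-Reasoning)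
open import Relation.Nullary using (¬_; Dec; yes; no; does; contradiction)
open import Relation.Nullary.Decidable using (_×-dec_; ¬?; decidable-stable; dec-true; dec-false)
open import Relation.Unary using (Pred; Decidable; _≐_)
import Algebra.Properties.CommutativeSemigroup as CommutativeSemigroupProperties
import Algebra.Properties.Group as GroupProperties
open import Algebra.Bundles using (AbelianGroup)
open import Defs

private
  variable
    n : ℕ
    a b : Subset n

  module ℤGroup = GroupProperties (AbelianGroup.group ℤ.+-0-abelianGroup)

-- Integer arithmetic for shifted degrees.

m+i≡k⇒m≡k-i : ∀ {k : ℤ} {m i : ℕ} → + (m + i) ≡ k → + m ≡ k - + i
m+i≡k⇒m≡k-i {k} {m} {i} eq = ℤGroup.x≈z//y (+ m) (+ i) k (trans (sym (ℤ.pos-+ m i)) eq)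

m≡k-i⇒m+i≡k : ∀ {k : ℤ} {m i : ℕ} → + m ≡ k - + i → + (m + i) ≡ k
m≡k-i⇒m+i≡k {k} {m} {i} eq =
  trans (ℤ.pos-+ m i) (trans (cong (ℤ._+ + i) eq) (ℤGroup.//-rightDividesˡ (+ i) k))

infix 4 _≟ˢ_
_≟ˢ_ : B.DecidableEquality (Subset n)
_≟ˢ_ = ≡-dec _≟ᵇ_

⊆⇒≡⊎⊂ : a ⊆ b → a ≡ b ⊎ a ⊂ b
⊆⇒≡⊎⊂ {a = a} {b} a⊆b with Fin.any? (λ x → (x ∈? b) ×-dec ¬? (x ∈? a))
... | yes b∖a = inj₂ (a⊆b , b∖a)
... | no ¬b∖a = inj₁ (⊆-antisym a⊆b λ {x} x∈b →
  decidable-stable (x ∈? a) λ x∉a → ¬b∖a (x , x∈b , x∉a))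

-- Counting

count-cong : ∀ {Q R : Pred (Subset n) 0ℓ} (Q? : Decidable Q) (R? : Decidable R) →
             Q ≐ R → count Q? ≡ count R?
count-cong Q? R? Q≐R = cong length (filter-≐ Q? R? Q≐R (subsets _))

count-none : ∀ {Q : Pred (Subset n) 0ℓ} (Q? : Decidable Q) → (∀ {a} → ¬ Q a) → count Q? ≡ 0
count-none {n} Q? ¬q = cong length (filter-none Q? {subsets n} (All.tabulate λ _ → ¬q))

length-filter-map : ∀ {A B : Set} {Q : Pred B 0ℓ} (Q? : Decidable Q) (f : A → B) xs →
                    length (filter Q? (map f xs)) ≡ length (filter (λ x → Q? (f x)) xs)
length-filter-map Q? f []       = refl
length-filter-map Q? f (x ∷ xs) with does (Q? (f x))
... | true  = cong suc (length-filter-map Q? f xs)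
... | false = length-filter-map Q? f xs

-- The head bit tells the layers apart, so this is how every count over a layered family splits into
-- one summand per layer.
count-∷ : ∀ {Q : Pred (Subset (suc n)) 0ℓ} (Q? : Decidable Q) →
          count Q? ≡ count (λ a → Q? (inside ∷ a)) + count (λ a → Q? (outside ∷ a))
count-∷ {n} Q? = begin
  length (filter Q? (map (inside ∷_) (subsets n) ++ map (outside ∷_) (subsets n)))
    ≡⟨ cong length (filter-++ Q? (map (inside ∷_) (subsets n)) _) ⟩
  length (filter Q? (map (inside ∷_) (subsets n)) ++ filter Q? (map (outside ∷_) (subsets n)))
    ≡⟨ length-++ (filter Q? (map (inside ∷_) (subsets n))) ⟩
  length (filter Q? (map (inside ∷_) (subsets n))) + length (filter Q? (map (outside ∷_) (subsets n)))
    ≡⟨ cong₂ _+_ (length-filter-map Q? (inside ∷_) (subsets n)) (length-filter-map Q? (outside ∷_) (subsets n)) ⟩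
  count (λ a → Q? (inside ∷ a)) + count (λ a → Q? (outside ∷ a)) ∎
  where open ≡-Reasoning

count-partition : ∀ {Q R : Pred (Subset n) 0ℓ} (Q? : Decidable Q) (R? : Decidable R) →
                  count Q? ≡ count (λ a → R? a ×-dec Q? a) + count (λ a → ¬? (R? a) ×-dec Q? a)
count-partition {n} Q? R? = go (subsets n)
  where
  go : ∀ xs → length (filter Q? xs) ≡ length (filter (λ a → R? a ×-dec Q? a) xs)
                                     + length (filter (λ a → ¬? (R? a) ×-dec Q? a) xs)
  go []       = refl
  go (x ∷ xs) with does (R? x) | does (Q? x)
  ... | true  | true  = cong suc (go xs)
  ... | true  | false = go xs
  ... | false | true  = trans (cong suc (go xs)) (sym (+-suc _ _))
  ... | false | false = go xs

-- Iverson bracket: the contribution to a degree of the single cover that may lead into an adjacent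
-- layer.
⟦_⟧ : {X : Set} → Dec X → ℕ
⟦ X? ⟧ = if does X? then 1 else 0

⟦⟧-yes : {X : Set} (X? : Dec X) → X → ⟦ X? ⟧ ≡ 1
⟦⟧-yes X? x = cong (if_then 1 else 0) (dec-true X? x)

⟦⟧-no : {X : Set} (X? : Dec X) → ¬ X → ⟦ X? ⟧ ≡ 0
⟦⟧-no X? ¬x = cong (if_then 1 else 0) (dec-false X? ¬x)

⟦⟧-cong : {X Y : Set} (X? : Dec X) (Y? : Dec Y) → (X → Y) → (Y → X) → ⟦ X? ⟧ ≡ ⟦ Y? ⟧
⟦⟧-cong (yes x) Y? f g = sym (⟦⟧-yes Y? (f x))
⟦⟧-cong (no ¬x) Y? f g = sym (⟦⟧-no Y? (¬x ∘ g))

count-singleton : (a : Subset n) → count (λ b → b ≟ˢ a) ≡ 1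
count-singleton []            = refl
count-singleton (inside  ∷ a) = trans (count-∷ (λ b → b ≟ˢ inside ∷ a)) $ cong₂ _+_
  (trans (count-cong _ (_≟ˢ a) (∷-injectiveʳ , cong (inside ∷_))) (count-singleton a))
  (count-none (λ b → outside ∷ b ≟ˢ inside ∷ a) λ ())
count-singleton (outside ∷ a) = trans (count-∷ (λ b → b ≟ˢ outside ∷ a)) $ cong₂ _+_
  (count-none (λ b → inside ∷ b ≟ˢ outside ∷ a) λ ())
  (trans (count-cong _ (_≟ˢ a) (∷-injectiveʳ , cong (outside ∷_))) (count-singleton a))

count-≡ : ∀ {X : Set} {Q : Pred (Subset n) 0ℓ} (Q? : Decidable Q) (X? : Dec X) (a : Subset n) →
          (∀ {b} → Q b → X × b ≡ a) → (X → Q a) → count Q? ≡ ⟦ X? ⟧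
count-≡ Q? (yes x) a f g = trans
  (count-cong Q? (_≟ˢ a) (proj₂ ∘ f , λ { refl → g x })) (count-singleton a)
count-≡ Q? (no ¬x) a f g = count-none Q? (¬x ∘ proj₁ ∘ f)

-- Congruence of the degree statistics

infix 4 _≋_
-- Only the members matter for degrees. The filters of an expanded poset and its layered description
-- have different membership predicates and deciders, so they are compared up to this relation.
_≋_ : Rel (Family n) 0ℓ
M ≋ N = Mem M ≐ Mem N

≋-refl : (M : Family n) → M ≋ M
≋-refl M = (λ a∈M → a∈M) , (λ a∈M → a∈M)

Covers-resp : {M N : Family n} → M ≋ N → Covers M a b → Covers N a b
Covers-resp (f , g) (a∈M , b∈M , a⊏b , ¬c) =
  f a∈M , f b∈M , a⊏b , λ { (c , c∈N , p) → ¬c (c , g c∈N , p) }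

deg⁻-cong : (M N : Family n) → M ≋ N → ∀ a → deg⁻ M a ≡ deg⁻ N a
deg⁻-cong M N M≋N a = count-cong (covers? M a) (covers? N a)
  (Covers-resp {M = M} {N} M≋N , Covers-resp {M = N} {M} (swap M≋N))

deg⁺-cong : (M N : Family n) → M ≋ N → ∀ a → deg⁺ M a ≡ deg⁺ N a
deg⁺-cong M N M≋N a = count-cong (λ b → covers? M b a) (λ b → covers? N b a)
  (Covers-resp {M = M} {N} M≋N , Covers-resp {M = N} {M} (swap M≋N))

-- Unfolds to `d` and `d⁻` at `deg M` and `deg⁻ M`. Leaving the statistic free allows the sets of
-- one layer to be counted by their degree in the whole family.
countᶠ : (M : Family n) → (Subset n → ℕ) → ℤ → ℕ
countᶠ M f k = count λ a → mem? M a ×-dec (+ f a ℤ.≟ k)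

countᶠ-cong : (M N : Family n) (f g : Subset n → ℕ) (k : ℤ) → M ≋ N →
              (∀ {a} → Mem M a → f a ≡ g a) → countᶠ M f k ≡ countᶠ N g k
countᶠ-cong M N f g k (M⊆N , N⊆M) f≡g = count-cong
  (λ a → mem? M a ×-dec (+ f a ℤ.≟ k)) (λ a → mem? N a ×-dec (+ g a ℤ.≟ k))
  ( (λ (a∈M , eq) → M⊆N a∈M , trans (cong +_ (sym (f≡g a∈M))) eq)
  , (λ (a∈N , eq) → N⊆M a∈N , trans (cong +_ (f≡g (N⊆M a∈N))) eq) )

-- Source of the shifted indices in both identities. Over the integers no truncation occurs: for `k`
-- below `i` both sides count nothing.
countᶠ-shift : (M : Family n) (f g : Subset n → ℕ) (k : ℤ) (i : ℕ) →
               (∀ {a} → Mem M a → f a ≡ g a + i) → countᶠ M f k ≡ countᶠ M g (k - + i)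
countᶠ-shift M f g k i f≡g+i = count-cong
  (λ a → mem? M a ×-dec (+ f a ℤ.≟ k)) (λ a → mem? M a ×-dec (+ g a ℤ.≟ k - + i))
  ( (λ (a∈M , eq) → a∈M , m+i≡k⇒m≡k-i (trans (cong +_ (sym (f≡g+i a∈M))) eq))
  , (λ (a∈M , eq) → a∈M , trans (cong +_ (f≡g+i a∈M)) (m≡k-i⇒m+i≡k eq)) )

d-cong : (M N : Family n) (k : ℤ) → M ≋ N → d M k ≡ d N k
d-cong M N k M≋N = countᶠ-cong M N (deg M) (deg N) k M≋N
  λ {a} _ → cong₂ _+_ (deg⁻-cong M N M≋N a) (deg⁺-cong M N M≋N a)

d⁻-cong : (M N : Family n) (k : ℤ) → M ≋ N → d⁻ M k ≡ d⁻ N k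
d⁻-cong M N k M≋N = countᶠ-cong M N (deg⁻ M) (deg⁻ N) k M≋N
  λ {a} _ → deg⁻-cong M N M≋N a

-- Two-layer families

infixr 5 _▹_
-- Under reverse inclusion the `inside` layer `A` is the lower one, so covers between the layers
-- lead from `A` up to `B`.
_▹_ : Family n → Family n → Family (suc n)
A ▹ B = record
  { Mem  = λ { (inside ∷ a) → Mem A a  ; (outside ∷ a) → Mem B a }
  ; mem? = λ { (inside ∷ a) → mem? A a ; (outside ∷ a) → mem? B a }
  }

∅ᶠ : Family n
∅ᶠ = record { Mem = λ _ → ⊥ ; mem? = λ _ → no λ () }

-- The interpolant can be placed in either layer, which breaks any step between layers that changes
-- more than the new element.
Interpolates : Rel (Family n) 0ℓ
Interpolates A B = ∀ {a b} → Mem A a → Mem B b → b ⊆ a →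
  ∃ λ c → Mem A c × Mem B c × b ⊆ c × c ⊆ a

countᶠ-▹ : (A B : Family n) (f : Subset (suc n) → ℕ) (k : ℤ) →
           countᶠ (A ▹ B) f k ≡ countᶠ A (f ∘ (inside ∷_)) k + countᶠ B (f ∘ (outside ∷_)) k
countᶠ-▹ A B f k = count-∷ λ a → mem? (A ▹ B) a ×-dec (+ f a ℤ.≟ k)

module _ (A B : Family n) where

  covers-inside : Covers (A ▹ B) (inside ∷ a) (inside ∷ b) → Covers A a b
  covers-inside (a∈ , b∈ , b⊂a , ¬c) = a∈ , b∈ , drop-∷-⊂ b⊂a ,
    λ { (c , c∈ , c⊂a , b⊂c) → ¬c (inside ∷ c , c∈ , s⊂s c⊂a , s⊂s b⊂c) }

  -- A set of the other layer lacks the new element, which `inside ∷ b` has, so it cannot lie in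
  -- between.
  covers-inside⁺ : Covers A a b → Covers (A ▹ B) (inside ∷ a) (inside ∷ b)
  covers-inside⁺ (a∈ , b∈ , b⊂a , ¬c) = a∈ , b∈ , s⊂s b⊂a ,
    λ { (inside  ∷ c , c∈ , c⊂a , b⊂c) → ¬c (c , c∈ , drop-∷-⊂ c⊂a , drop-∷-⊂ b⊂c)
      ; (outside ∷ c , c∈ , c⊂a , b⊂c) → contradiction (proj₁ b⊂c here) λ () }

  covers-outside : Covers (A ▹ B) (outside ∷ a) (outside ∷ b) → Covers B a b
  covers-outside (a∈ , b∈ , b⊂a , ¬c) = a∈ , b∈ , drop-∷-⊂ b⊂a ,
    λ { (c , c∈ , c⊂a , b⊂c) → ¬c (outside ∷ c , c∈ , s⊂s c⊂a , s⊂s b⊂c) }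

  covers-outside⁺ : Covers B a b → Covers (A ▹ B) (outside ∷ a) (outside ∷ b)
  covers-outside⁺ (a∈ , b∈ , b⊂a , ¬c) = a∈ , b∈ , s⊂s b⊂a ,
    λ { (outside ∷ c , c∈ , c⊂a , b⊂c) → ¬c (c , c∈ , drop-∷-⊂ c⊂a , drop-∷-⊂ b⊂c)
      ; (inside  ∷ c , c∈ , c⊂a , b⊂c) → contradiction (proj₁ c⊂a here) λ () }

  ¬covers-upward : ¬ Covers (A ▹ B) (outside ∷ a) (inside ∷ b)
  ¬covers-upward (_ , _ , b⊂a , _) = contradiction (proj₁ b⊂a here) λ ()

  -- The two sets differ only in the new element, so anything between them agrees with one of them.
  covers-diagonal : Mem A a × Mem B a → Covers (A ▹ B) (inside ∷ a) (outside ∷ a)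
  covers-diagonal (a∈A , a∈B) = a∈A , a∈B , out⊂in ⊆-refl ,
    λ { (inside  ∷ c , _ , c⊂a , a⊂c) → let (_ , x , x∈a , x∉c) = drop-∷-⊂ c⊂a
                                        in x∉c (drop-∷-⊆ (proj₁ a⊂c) x∈a)
      ; (outside ∷ c , _ , c⊂a , a⊂c) → let (_ , x , x∈c , x∉a) = drop-∷-⊂ a⊂c
                                        in x∉a (drop-∷-⊆ (proj₁ c⊂a) x∈c) }

  -- The interpolant gives `inside ∷ a ⊇ inside ∷ c ⊃ outside ∷ c ⊇ outside ∷ b`. The middle
  -- inclusion is strict, so in a cover both outer ones are equalities.
  covers-across : Interpolates A B → Covers (A ▹ B) (inside ∷ a) (outside ∷ b) →
                  (Mem A a × Mem B a) × b ≡ a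
  covers-across interpolate (a∈A , b∈B , b⊂a , ¬c)
    with interpolate a∈A b∈B (drop-∷-⊆ (proj₁ b⊂a))
  ... | c , c∈A , c∈B , b⊆c , c⊆a with ⊆⇒≡⊎⊂ b⊆c | ⊆⇒≡⊎⊂ c⊆a
  ...   | inj₁ refl | inj₁ refl = (a∈A , b∈B) , refl
  ...   | _         | inj₂ c⊂a  = contradiction (inside ∷ c , c∈A , s⊂s c⊂a , out⊂in b⊆c) ¬c
  ...   | inj₂ b⊂c  | _         = contradiction (outside ∷ c , c∈B , out⊂in c⊆a , s⊂s b⊂c) ¬c

  private
    covers▹? : B.Decidable (Covers (A ▹ B))
    covers▹? = covers? (A ▹ B)

  -- Going down only adds elements, so the new element is kept and `B` contributes 0. Dually,
  -- `deg⁻-outside` gets nothing from `A`.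
  deg⁺-inside : ∀ a → deg⁺ (A ▹ B) (inside ∷ a) ≡ deg⁺ A a
  deg⁺-inside a = begin
    deg⁺ (A ▹ B) (inside ∷ a)
      ≡⟨ count-∷ (λ b → covers▹? b (inside ∷ a)) ⟩
    count (λ b → covers▹? (inside ∷ b) (inside ∷ a)) + count (λ b → covers▹? (outside ∷ b) (inside ∷ a))
      ≡⟨ cong₂ _+_
           (count-cong (λ b → covers▹? (inside ∷ b) (inside ∷ a)) (λ b → covers? A b a)
             (covers-inside , covers-inside⁺))
           (count-none (λ b → covers▹? (outside ∷ b) (inside ∷ a)) ¬covers-upward) ⟩
    deg⁺ A a + 0
      ≡⟨ +-identityʳ _ ⟩
    deg⁺ A a ∎
    where open ≡-Reasoning

  deg⁻-outside : ∀ a → deg⁻ (A ▹ B) (outside ∷ a) ≡ deg⁻ B a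
  deg⁻-outside a = trans (count-∷ (covers▹? (outside ∷ a))) $ cong₂ _+_
    (count-none (λ b → covers▹? (outside ∷ a) (inside ∷ b)) ¬covers-upward)
    (count-cong (λ b → covers▹? (outside ∷ a) (outside ∷ b)) (covers? B a)
      (covers-outside , covers-outside⁺))

  module _ (interpolate : Interpolates A B) where

    deg⁻-inside : ∀ a → deg⁻ (A ▹ B) (inside ∷ a) ≡ deg⁻ A a + ⟦ mem? A a ×-dec mem? B a ⟧
    deg⁻-inside a = trans (count-∷ (covers▹? (inside ∷ a))) $ cong₂ _+_
      (count-cong (λ b → covers▹? (inside ∷ a) (inside ∷ b)) (covers? A a)
        (covers-inside , covers-inside⁺))
      (count-≡ (λ b → covers▹? (inside ∷ a) (outside ∷ b)) (mem? A a ×-dec mem? B a) a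
        (covers-across interpolate) covers-diagonal)

    deg⁺-outside : ∀ a → deg⁺ (A ▹ B) (outside ∷ a) ≡ deg⁺ B a + ⟦ mem? A a ×-dec mem? B a ⟧
    deg⁺-outside a = begin
      deg⁺ (A ▹ B) (outside ∷ a)
        ≡⟨ count-∷ (λ b → covers▹? b (outside ∷ a)) ⟩
      count (λ b → covers▹? (inside ∷ b) (outside ∷ a)) + count (λ b → covers▹? (outside ∷ b) (outside ∷ a))
        ≡⟨ cong₂ _+_
             (count-≡ (λ b → covers▹? (inside ∷ b) (outside ∷ a)) (mem? A a ×-dec mem? B a) a
               (λ cov → let (p , a≡b) = covers-across interpolate cov
                        in subst (λ c → Mem A c × Mem B c) (sym a≡b) p , sym a≡b)
               covers-diagonal)
             (count-cong (λ b → covers▹? (outside ∷ b) (outside ∷ a)) (λ b → covers? B b a)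
               (covers-outside , covers-outside⁺)) ⟩
      ⟦ mem? A a ×-dec mem? B a ⟧ + deg⁺ B a
        ≡⟨ +-comm _ (deg⁺ B a) ⟩
      deg⁺ B a + ⟦ mem? A a ×-dec mem? B a ⟧ ∎
      where open ≡-Reasoning

-- Restrictions of a family and convex subfamilies.

infixl 6 _∩ᶠ_ _∖ᶠ_
-- Membership in `N` comes first, in the order in which `count-partition` delivers it, so that
-- `countᶠ-partition` only has to reassociate.
_∩ᶠ_ _∖ᶠ_ : Family n → Family n → Family n
M ∩ᶠ N = record { Mem = λ a → Mem N a × Mem M a ; mem? = λ a → mem? N a ×-dec mem? M a }
M ∖ᶠ N = record { Mem = λ a → ¬ Mem N a × Mem M a ; mem? = λ a → ¬? (mem? N a) ×-dec mem? M a }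

countᶠ-partition : (M N : Family n) (f : Subset n → ℕ) (k : ℤ) →
                   countᶠ M f k ≡ countᶠ (M ∩ᶠ N) f k + countᶠ (M ∖ᶠ N) f k
countᶠ-partition M N f k = trans
  (count-partition (λ a → mem? M a ×-dec (+ f a ℤ.≟ k)) (mem? N))
  (cong₂ _+_
    (count-cong (λ a → mem? N a ×-dec mem? M a ×-dec (+ f a ℤ.≟ k))
                (λ a → (mem? N a ×-dec mem? M a) ×-dec (+ f a ℤ.≟ k)) (assocˡ′ , assocʳ′))
    (count-cong (λ a → ¬? (mem? N a) ×-dec mem? M a ×-dec (+ f a ℤ.≟ k))
                (λ a → (¬? (mem? N a) ×-dec mem? M a) ×-dec (+ f a ℤ.≟ k)) (assocˡ′ , assocʳ′)))

-- By convexity, whatever `M` has between two members of `N` is in `N`, so both families have the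
-- same covers inside `N`. The last hypothesis keeps every upper cover of `a` inside `N`.
deg⁻-convex : (M N : Family n) → (∀ {a} → Mem N a → Mem M a) →
              (∀ {a b c} → Mem N a → Mem N b → Mem M c → b ⊆ c → c ⊆ a → Mem N c) →
              ∀ {a} → Mem N a → (∀ {b} → Covers M a b → Mem N b) → deg⁻ M a ≡ deg⁻ N a
deg⁻-convex M N N⊆M convex {a} a∈N covers∈N = count-cong (covers? M a) (covers? N a)
  ( (λ cov@(_ , _ , b⊂a , ¬c) → a∈N , covers∈N cov , b⊂a ,
      λ { (c , c∈N , c⊂a , b⊂c) → ¬c (c , N⊆M c∈N , c⊂a , b⊂c) })
  , (λ (_ , b∈N , b⊂a , ¬c) → N⊆M a∈N , N⊆M b∈N , b⊂a ,
      λ { (c , c∈M , c⊂a , b⊂c) →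
            ¬c (c , convex a∈N b∈N c∈M (proj₁ b⊂c) (proj₁ c⊂a) , c⊂a , b⊂c) }) )

-- Minimal elements in a finite poset.

minimal-below : {_≤_ : Rel (Fin n) 0ℓ} → IsPartialOrder _≡_ _≤_ → B.Decidable _≤_ →
                {Q : Pred (Fin n) 0ℓ} → Decidable Q → ∀ {y} → Q y →
                ∃ λ s → (Q s × (∀ t → Q t → t ≤ s → t ≡ s)) × s ≤ y
minimal-below {_≤_ = _≤_} isPO _≤?_ {Q} Q? {y} = go (po-wellFounded isPO y)
  where
  module O = IsPartialOrder isPO
  go : ∀ {y} → Acc _ y → Q y → ∃ λ s → (Q s × (∀ t → Q t → t ≤ s → t ≡ s)) × s ≤ y
  go {y} (acc rec) y∈Q
    -- Descend to a strictly smaller element of `Q` as long as there is one; where there is none,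
    -- `y` is minimal.
    with Fin.any? (λ t → Q? t ×-dec (t ≤? y) ×-dec ¬? (t Fin.≟ y))
  ... | yes (t , t∈Q , t≤y , t≢y) =
    let s , s-min , s≤t = go (rec (t≤y , t≢y)) t∈Q
    in  s , s-min , O.trans s≤t t≤y
  ... | no ¬t = y ,
    (y∈Q , λ t t∈Q t≤y → decidable-stable (t Fin.≟ y) λ t≢y → ¬t (t , t∈Q , t≤y , t≢y)) , O.refl

-- The filters of the expanded posets as layered families.

module _ {n : ℕ} (P : FinPoset n) (K : Cutting P) where
  open IsDecPartialOrder (FinPoset.isDecPartialOrder P) using (isPartialOrder; _≤?_)
  open Cutting K
  open Expansion P K

  private
    L A B : Family n
    L = 𝓕 P
    A = record { Mem  = λ a → IsFilter P a × 1̂ ⊆ a ; mem? = λ a → isFilter? P a ×-dec (1̂ ⊆? a) }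
    B = record { Mem  = λ a → IsFilter P a × a ⊆ 0̂ ; mem? = λ a → isFilter? P a ×-dec (a ⊆? 0̂) }

    M₁ : Family (suc n)
    M₁ = A ▹ B

    -- The head bit stands for `x₁`, the next one for `x₂`. The layer with `x₁` but not `x₂` is
    -- empty because `x₁ < x₂`.
    M₂ : Family (suc (suc n))
    M₂ = (A ▹ ∅ᶠ) ▹ (interval ▹ B)

  -- Converse of `above⇒∈1̂`: the elements above a new one are exactly those of `1̂`, which a filter
  -- containing it must include.
  ∈1̂⇒above : ∀ {y} → y ∈ 1̂ → AboveS₁ y
  ∈1̂⇒above = minimal-below isPartialOrder _≤?_ (_∈? 1̂)

  -- Maximal elements are minimal for the flipped order. With `below⇒∉0̂`, a filter without a given
  -- new element is exactly one that stays inside `0̂`.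
  ∉0̂⇒below : ∀ {z} → z ∉ 0̂ → BelowS₀ z
  ∉0̂⇒below = minimal-below (Flip.isPartialOrder isPartialOrder) (λ x y → y ≤? x) (λ z → ¬? (z ∈? 0̂))

  ⊞≋ : (P ⊞ K) ≋ M₁
  ⊞≋ = (λ {a} → to a) , (λ {a} → from a)
    where
    to : ∀ a → Mem (P ⊞ K) a → Mem M₁ a
    to (inside ∷ a) F =
      (λ x y x≤y x∈a → drop-there (F (suc x) (suc y) x≤y (there x∈a))) ,
      (λ {y} y∈1̂ → drop-there (F zero (suc y) (∈1̂⇒above y∈1̂) here))
    to (outside ∷ a) F =
      (λ x y x≤y x∈a → drop-there (F (suc x) (suc y) x≤y (there x∈a))) ,
      (λ {z} z∈a → decidable-stable (z ∈? 0̂) λ z∉0̂ →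
        contradiction (F (suc z) zero (∉0̂⇒below z∉0̂) (there z∈a)) λ ())

    from : ∀ a → Mem M₁ a → Mem (P ⊞ K) a
    from (inside ∷ a) (F , 1̂⊆a) = λ
      { zero    zero    _   _           → here
      ; zero    (suc y) y↑  _           → there (1̂⊆a (above⇒∈1̂ y↑))
      ; (suc x) zero    _   _           → here
      ; (suc x) (suc y) x≤y (there x∈a) → there (F x y x≤y x∈a) }
    from (outside ∷ a) (F , a⊆0̂) = λ
      { (suc x) zero    x↓  (there x∈a) → contradiction (a⊆0̂ x∈a) (below⇒∉0̂ x↓)
      ; (suc x) (suc y) x≤y (there x∈a) → there (F x y x≤y x∈a) }

  -- Absence of `x₁` forces `a ⊆ 0̂` and presence of `x₂` forces `1̂ ⊆ a`. The layer where both
  -- happen is therefore a copy of `interval`.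
  ⊞⊞≋ : (P ⊞⊞ K) ≋ M₂
  ⊞⊞≋ = (λ {a} → to a) , (λ {a} → from a)
    where
    filter⁻ : ∀ {s t a} → Mem (P ⊞⊞ K) (s ∷ t ∷ a) → IsFilter P a
    filter⁻ F x y x≤y x∈a = drop-there (drop-there (F (suc (suc x)) (suc (suc y)) x≤y (there (there x∈a))))

    ⊆0̂ : ∀ {t a} → Mem (P ⊞⊞ K) (outside ∷ t ∷ a) → a ⊆ 0̂
    ⊆0̂ F {z} z∈a = decidable-stable (z ∈? 0̂) λ z∉0̂ →
      contradiction (F (suc (suc z)) zero (∉0̂⇒below z∉0̂) (there (there z∈a))) λ ()

    1̂⊆ : ∀ {s a} → Mem (P ⊞⊞ K) (s ∷ inside ∷ a) → 1̂ ⊆ a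
    1̂⊆ F {y} y∈1̂ = drop-there (drop-there (F (suc zero) (suc (suc y)) (∈1̂⇒above y∈1̂) (there here)))

    to : ∀ a → Mem (P ⊞⊞ K) a → Mem M₂ a
    to (inside  ∷ inside  ∷ a) F = filter⁻ F , 1̂⊆ F
    to (inside  ∷ outside ∷ a) F = contradiction (F zero (suc zero) _ here) λ { (there ()) }
    to (outside ∷ inside  ∷ a) F = filter⁻ F , ⊆0̂ F , 1̂⊆ F
    to (outside ∷ outside ∷ a) F = filter⁻ F , ⊆0̂ F

    from : ∀ a → Mem M₂ a → Mem (P ⊞⊞ K) a
    from (inside ∷ inside ∷ a) (F , 1̂⊆a) = λ
      { _             zero          _   _                   → here
      ; _             (suc zero)    _   _                   → there here
      ; zero          (suc (suc y)) y↑  _                   → there (there (1̂⊆a (above⇒∈1̂ y↑)))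
      ; (suc zero)    (suc (suc y)) y↑  _                   → there (there (1̂⊆a (above⇒∈1̂ y↑)))
      ; (suc (suc x)) (suc (suc y)) x≤y (there (there x∈a)) → there (there (F x y x≤y x∈a)) }
    from (outside ∷ inside ∷ a) (F , a⊆0̂ , 1̂⊆a) = λ
      { (suc (suc x)) zero          x↓  (there (there x∈a)) → contradiction (a⊆0̂ x∈a) (below⇒∉0̂ x↓)
      ; _             (suc zero)    _   _                   → there here
      ; (suc zero)    (suc (suc y)) y↑  _                   → there (there (1̂⊆a (above⇒∈1̂ y↑)))
      ; (suc (suc x)) (suc (suc y)) x≤y (there (there x∈a)) → there (there (F x y x≤y x∈a)) }
    from (outside ∷ outside ∷ a) (F , a⊆0̂) = λ
      { (suc (suc x)) zero          x↓  (there (there x∈a)) → contradiction (a⊆0̂ x∈a) (below⇒∉0̂ x↓)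
      ; (suc (suc x)) (suc zero)    x↓  (there (there x∈a)) → contradiction (a⊆0̂ x∈a) (below⇒∉0̂ x↓)
      ; (suc zero)    _             _   (there ())
      ; (suc (suc x)) (suc (suc y)) x≤y (there (there x∈a)) → there (there (F x y x≤y x∈a)) }

  -- Interpolation between the layers.

  A∩B⇒K : Mem A a → Mem B a → Mem interval a
  A∩B⇒K (F , 1̂⊆a) (_ , a⊆0̂) = F , a⊆0̂ , 1̂⊆a

  K⇒A : Mem interval a → Mem A a
  K⇒A (F , _ , 1̂⊆a) = F , 1̂⊆a

  K⇒B : Mem interval a → Mem B a
  K⇒B (F , a⊆0̂ , _) = F , a⊆0̂

  -- Intersecting with `0̂` loses nothing of `1̂`, because `1̂ ⊆ 0̂`.
  A⇒∩0̂∈K : Mem A a → Mem interval (a ∩ 0̂)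
  A⇒∩0̂∈K {a} (F , 1̂⊆a) =
    (λ x y x≤y x∈ → let x∈a , x∈0̂ = x∈p∩q⁻ a 0̂ x∈
                    in x∈p∩q⁺ (F x y x≤y x∈a , 0̂∈𝓕 x y x≤y x∈0̂)) ,
    p∩q⊆q a 0̂ ,
    (λ x∈1̂ → x∈p∩q⁺ (1̂⊆a x∈1̂ , 0̂⊑1̂ x∈1̂))

  ⊆∩0̂ : b ⊆ 0̂ → b ⊆ a → b ⊆ a ∩ 0̂
  ⊆∩0̂ b⊆0̂ b⊆a x∈b = x∈p∩q⁺ (b⊆a x∈b , b⊆0̂ x∈b)

  interpolates-A-B : Interpolates A B
  interpolates-A-B {a} {b} a∈A (_ , b⊆0̂) b⊆a =
    a ∩ 0̂ , K⇒A a∩0̂∈K , K⇒B a∩0̂∈K , ⊆∩0̂ b⊆0̂ b⊆a , p∩q⊆p a 0̂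
    where a∩0̂∈K = A⇒∩0̂∈K a∈A

  interpolates-A-∅ : Interpolates A ∅ᶠ
  interpolates-A-∅ _ ()

  interpolates-K-B : Interpolates interval B
  interpolates-K-B {a} a∈K _ b⊆a = a , a∈K , K⇒B a∈K , b⊆a , ⊆-refl

  -- An interpolant must have `x₂`, since the other half of the `x₁` layer is empty. For `b` without
  -- `x₂` it passes through the middle layer, so no cover skips from the top to the bottom clause of
  -- `M₂`.
  interpolates-M₂ : Interpolates (A ▹ ∅ᶠ) (interval ▹ B)
  interpolates-M₂ {inside ∷ a} {inside ∷ b} a∈A (_ , b⊆0̂ , _) b⊆a =
    inside ∷ a ∩ 0̂ , K⇒A a∩0̂∈K , a∩0̂∈K , s⊆s (⊆∩0̂ b⊆0̂ (drop-∷-⊆ b⊆a)) , s⊆s (p∩q⊆p a 0̂)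
    where a∩0̂∈K = A⇒∩0̂∈K a∈A
  interpolates-M₂ {inside ∷ a} {outside ∷ b} a∈A (_ , b⊆0̂) b⊆a =
    inside ∷ a ∩ 0̂ , K⇒A a∩0̂∈K , a∩0̂∈K , out⊆ (⊆∩0̂ b⊆0̂ (drop-∷-⊆ b⊆a)) , s⊆s (p∩q⊆p a 0̂)
    where a∩0̂∈K = A⇒∩0̂∈K a∈A

  -- Degrees layer by layer and the first identity.

  deg-top : ∀ a → deg M₂ (inside ∷ inside ∷ a) ≡ deg M₁ (inside ∷ a)
  deg-top a = cong₂ _+_
    (begin
      deg⁻ M₂ (inside ∷ inside ∷ a)
        ≡⟨ deg⁻-inside (A ▹ ∅ᶠ) (interval ▹ B) interpolates-M₂ (inside ∷ a) ⟩
      deg⁻ (A ▹ ∅ᶠ) (inside ∷ a) + ⟦ mem? A a ×-dec mem? interval a ⟧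
        -- Within `A`, lying in `interval` and lying in `B` are the same condition, so the middle
        -- layer supplies the upper cover that `B` supplies in `M₁`.
        ≡⟨ cong₂ _+_ (deg⁻-inside A ∅ᶠ interpolates-A-∅ a)
             (⟦⟧-cong (mem? A a ×-dec mem? interval a) (mem? A a ×-dec mem? B a)
               (λ (a∈A , a∈K) → a∈A , K⇒B a∈K) (λ (a∈A , a∈B) → a∈A , A∩B⇒K a∈A a∈B)) ⟩
      (deg⁻ A a + ⟦ mem? A a ×-dec mem? ∅ᶠ a ⟧) + ⟦ mem? A a ×-dec mem? B a ⟧
        ≡⟨ cong (_+ ⟦ mem? A a ×-dec mem? B a ⟧)
             (trans (cong (λ i → deg⁻ A a + i) (⟦⟧-no (mem? A a ×-dec mem? ∅ᶠ a) proj₂)) (+-identityʳ _)) ⟩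
      deg⁻ A a + ⟦ mem? A a ×-dec mem? B a ⟧
        ≡⟨ deg⁻-inside A B interpolates-A-B a ⟨
      deg⁻ M₁ (inside ∷ a) ∎)
    (begin
      deg⁺ M₂ (inside ∷ inside ∷ a)  ≡⟨ deg⁺-inside (A ▹ ∅ᶠ) (interval ▹ B) (inside ∷ a) ⟩
      deg⁺ (A ▹ ∅ᶠ) (inside ∷ a)     ≡⟨ deg⁺-inside A ∅ᶠ a ⟩
      deg⁺ A a                       ≡⟨ deg⁺-inside A B a ⟨
      deg⁺ M₁ (inside ∷ a)           ∎)
    where open ≡-Reasoning

  -- A member of `interval` is also in `A` and in `B`, hence gains one cover on each side.
  deg-middle : Mem interval a → deg M₂ (outside ∷ inside ∷ a) ≡ deg interval a + 2
  deg-middle {a} a∈K = begin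
    deg⁻ M₂ (outside ∷ inside ∷ a) + deg⁺ M₂ (outside ∷ inside ∷ a)
      ≡⟨ cong₂ _+_
           (trans (deg⁻-outside (A ▹ ∅ᶠ) (interval ▹ B) (inside ∷ a))
                  (deg⁻-inside interval B interpolates-K-B a))
           (trans (deg⁺-outside (A ▹ ∅ᶠ) (interval ▹ B) interpolates-M₂ (inside ∷ a))
                  (cong (_+ ⟦ mem? A a ×-dec mem? interval a ⟧) (deg⁺-inside interval B a))) ⟩
    (deg⁻ interval a + ⟦ mem? interval a ×-dec mem? B a ⟧)
      + (deg⁺ interval a + ⟦ mem? A a ×-dec mem? interval a ⟧)
      ≡⟨ cong₂ (λ i j → (deg⁻ interval a + i) + (deg⁺ interval a + j))
           (⟦⟧-yes (mem? interval a ×-dec mem? B a) (a∈K , K⇒B a∈K))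
           (⟦⟧-yes (mem? A a ×-dec mem? interval a) (K⇒A a∈K , a∈K)) ⟩
    (deg⁻ interval a + 1) + (deg⁺ interval a + 1)
      ≡⟨ interchange (deg⁻ interval a) 1 (deg⁺ interval a) 1 ⟩
    deg interval a + 2 ∎
    where
    open ≡-Reasoning
    open CommutativeSemigroupProperties +-commutativeSemigroup using (interchange)

  deg-bottom : ∀ a → deg M₂ (outside ∷ outside ∷ a) ≡ deg M₁ (outside ∷ a)
  deg-bottom a = cong₂ _+_
    (begin
      deg⁻ M₂ (outside ∷ outside ∷ a)    ≡⟨ deg⁻-outside (A ▹ ∅ᶠ) (interval ▹ B) (outside ∷ a) ⟩
      deg⁻ (interval ▹ B) (outside ∷ a)  ≡⟨ deg⁻-outside interval B a ⟩
      deg⁻ B a                           ≡⟨ deg⁻-outside A B a ⟨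
      deg⁻ M₁ (outside ∷ a)              ∎)
    (begin
      deg⁺ M₂ (outside ∷ outside ∷ a)
        -- The bracket computes to 0: a copy of `a` with `x₁` but without `x₂` would lie in `∅ᶠ`.
        ≡⟨ deg⁺-outside (A ▹ ∅ᶠ) (interval ▹ B) interpolates-M₂ (outside ∷ a) ⟩
      deg⁺ (interval ▹ B) (outside ∷ a) + 0
        ≡⟨ +-identityʳ _ ⟩
      deg⁺ (interval ▹ B) (outside ∷ a)
        ≡⟨ deg⁺-outside interval B interpolates-K-B a ⟩
      deg⁺ B a + ⟦ mem? interval a ×-dec mem? B a ⟧
        ≡⟨ cong (λ i → deg⁺ B a + i)
             (⟦⟧-cong (mem? interval a ×-dec mem? B a) (mem? A a ×-dec mem? B a)
               (λ (a∈K , a∈B) → K⇒A a∈K , a∈B) (λ (a∈A , a∈B) → A∩B⇒K a∈A a∈B , a∈B)) ⟩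
      deg⁺ B a + ⟦ mem? A a ×-dec mem? B a ⟧
        ≡⟨ deg⁺-outside A B interpolates-A-B a ⟨
      deg⁺ M₁ (outside ∷ a) ∎)
    where open ≡-Reasoning

  -- The outer layers keep their degrees from `M₁` and add up to `d (P ⊞ K) k`; the middle layer is
  -- `interval` with every degree raised by 2.
  d-⊞⊞ : ∀ k → d (P ⊞⊞ K) k ≡ d (P ⊞ K) k + d interval (k - + 2)
  d-⊞⊞ k = begin
    d (P ⊞⊞ K) k
      ≡⟨ d-cong (P ⊞⊞ K) M₂ k ⊞⊞≋ ⟩
    countᶠ M₂ (deg M₂) k
      ≡⟨ countᶠ-▹ (A ▹ ∅ᶠ) (interval ▹ B) (deg M₂) k ⟩
    countᶠ (A ▹ ∅ᶠ) (deg M₂ ∘ (inside ∷_)) k + countᶠ (interval ▹ B) (deg M₂ ∘ (outside ∷_)) k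
      ≡⟨ cong₂ _+_
           (countᶠ-▹ A ∅ᶠ (deg M₂ ∘ (inside ∷_)) k)
           (countᶠ-▹ interval B (deg M₂ ∘ (outside ∷_)) k) ⟩
    (countᶠ A (λ a → deg M₂ (inside ∷ inside ∷ a)) k + countᶠ ∅ᶠ (λ a → deg M₂ (inside ∷ outside ∷ a)) k)
      + (countᶠ interval (λ a → deg M₂ (outside ∷ inside ∷ a)) k + countᶠ B (λ a → deg M₂ (outside ∷ outside ∷ a)) k)
      ≡⟨ cong₂ _+_
           (cong₂ _+_
             (countᶠ-cong A A _ (deg M₁ ∘ (inside ∷_)) k (≋-refl A) (λ {a} _ → deg-top a))
             (count-none (λ a → mem? ∅ᶠ a ×-dec (+ deg M₂ (inside ∷ outside ∷ a) ℤ.≟ k)) proj₁))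
           (cong₂ _+_
             (countᶠ-shift interval _ (deg interval) k 2 deg-middle)
             (countᶠ-cong B B _ (deg M₁ ∘ (outside ∷_)) k (≋-refl B) (λ {a} _ → deg-bottom a))) ⟩
    (top + 0) + (d interval (k - + 2) + bottom)
      ≡⟨ cong₂ _+_ (+-identityʳ top) (+-comm (d interval (k - + 2)) bottom) ⟩
    top + (bottom + d interval (k - + 2))
      ≡⟨ +-assoc top bottom _ ⟨
    (top + bottom) + d interval (k - + 2)
      ≡⟨ cong (_+ d interval (k - + 2)) (countᶠ-▹ A B (deg M₁) k) ⟨
    d M₁ k + d interval (k - + 2)
      ≡⟨ cong (_+ d interval (k - + 2)) (d-cong (P ⊞ K) M₁ k ⊞≋) ⟨
    d (P ⊞ K) k + d interval (k - + 2) ∎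
    where
    open ≡-Reasoning
    top bottom : ℕ
    top    = countᶠ A (deg M₁ ∘ (inside ∷_)) k
    bottom = countᶠ B (deg M₁ ∘ (outside ∷_)) k

  -- Upper covers in `L` and the second identity.

  L⇒A⊎B : Mem L a → Mem A a ⊎ Mem B a
  L⇒A⊎B F with maximalChainThrough L F
  -- A maximal chain through `a` meets the cutting in some `c` comparable with `a`; the two
  -- directions of comparison give the two cases.
  ... | C , max@((_ , comp) , _) , a∈C with meets C max
  ...   | c , c∈C , _ , c⊆0̂ , 1̂⊆c with comp a∈C c∈C
  ...     | inj₁ c⊆a = inj₁ (F , ⊆-trans 1̂⊆c c⊆a)
  ...     | inj₂ a⊆c = inj₂ (F , ⊆-trans a⊆c c⊆0̂)

  -- Upper covers are subsets, so they stay inside `0̂`. The same argument settles `deg⁻-A-K`.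
  deg⁻-L-B : Mem B a → deg⁻ L a ≡ deg⁻ B a
  deg⁻-L-B a∈B@(_ , a⊆0̂) = deg⁻-convex L B proj₁
    (λ (_ , a⊆0̂) _ c∈L _ c⊆a → c∈L , ⊆-trans c⊆a a⊆0̂) a∈B
    (λ (_ , b∈L , b⊂a , _) → b∈L , ⊆-trans (proj₁ b⊂a) a⊆0̂)

  deg⁻-A-K : Mem interval a → deg⁻ A a ≡ deg⁻ interval a
  deg⁻-A-K a∈K@(_ , a⊆0̂ , _) = deg⁻-convex A interval K⇒A
    (λ (_ , a⊆0̂ , _) _ (F , 1̂⊆c) _ c⊆a → F , ⊆-trans c⊆a a⊆0̂ , 1̂⊆c) a∈K
    (λ (_ , (F , 1̂⊆b) , b⊂a , _) → F , ⊆-trans (proj₁ b⊂a) a⊆0̂ , 1̂⊆b)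

  -- If the cover `b` were only in `B`, an interpolant in both `A` and `B` would differ from `b`,
  -- and from `a` since `a` is not in `B`; it would lie strictly between.
  cover-of-A∖B : Mem A a → ¬ Mem B a → Covers L a b → Mem A b
  cover-of-A∖B a∈A a∉B (_ , b∈L , b⊂a , ¬c) with L⇒A⊎B b∈L
  ... | inj₁ b∈A = b∈A
  ... | inj₂ b∈B with interpolates-A-B a∈A b∈B (proj₁ b⊂a)
  ...   | c , c∈A , c∈B , b⊆c , c⊆a with ⊆⇒≡⊎⊂ b⊆c | ⊆⇒≡⊎⊂ c⊆a
  ...     | inj₁ refl | _         = c∈A
  ...     | _         | inj₁ refl = contradiction c∈B a∉B
  ...     | inj₂ b⊂c  | inj₂ c⊂a  = contradiction (c , proj₁ c∈A , c⊂a , b⊂c) ¬c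

  deg⁻-L-A : Mem A a → ¬ Mem B a → deg⁻ L a ≡ deg⁻ A a
  deg⁻-L-A a∈A a∉B = deg⁻-convex L A proj₁
    (λ _ (_ , 1̂⊆b) c∈L b⊆c _ → c∈L , ⊆-trans 1̂⊆b b⊆c) a∈A (cover-of-A∖B a∈A a∉B)

  deg⁻-M₁-K : Mem interval a → deg⁻ M₁ (inside ∷ a) ≡ deg⁻ interval a + 1
  deg⁻-M₁-K {a} a∈K = trans (deg⁻-inside A B interpolates-A-B a)
    (cong₂ _+_ (deg⁻-A-K a∈K) (⟦⟧-yes (mem? A a ×-dec mem? B a) (K⇒A a∈K , K⇒B a∈K)))

  deg⁻-M₁-A∖B : Mem (A ∖ᶠ B) a → deg⁻ M₁ (inside ∷ a) ≡ deg⁻ L a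
  deg⁻-M₁-A∖B {a} (a∉B , a∈A) = begin
    deg⁻ M₁ (inside ∷ a)                    ≡⟨ deg⁻-inside A B interpolates-A-B a ⟩
    deg⁻ A a + ⟦ mem? A a ×-dec mem? B a ⟧  ≡⟨ cong₂ _+_ (sym (deg⁻-L-A a∈A a∉B))
                                                 (⟦⟧-no (mem? A a ×-dec mem? B a) (a∉B ∘ proj₂)) ⟩
    deg⁻ L a + 0                            ≡⟨ +-identityʳ _ ⟩
    deg⁻ L a                                ∎
    where open ≡-Reasoning

  -- The `inside` layer splits into `interval`, whose degrees rise by 1, and `A ∖ᶠ B`, which keeps
  -- its degrees from `L`. By `L⇒A⊎B` the latter is `L ∖ᶠ B`, and together with the `outside` layer
  -- it recovers `L`.
  d⁻-⊞ : ∀ k → d⁻ (P ⊞ K) k ≡ d⁻ L k + d⁻ interval (k - + 1)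
  d⁻-⊞ k = begin
    d⁻ (P ⊞ K) k
      ≡⟨ d⁻-cong (P ⊞ K) M₁ k ⊞≋ ⟩
    countᶠ M₁ (deg⁻ M₁) k
      ≡⟨ countᶠ-▹ A B (deg⁻ M₁) k ⟩
    countᶠ A f k + countᶠ B (deg⁻ M₁ ∘ (outside ∷_)) k
      ≡⟨ cong₂ _+_ (countᶠ-partition A B f k)
           (countᶠ-cong B (L ∩ᶠ B) _ (deg⁻ L) k ((λ a∈B → a∈B , proj₁ a∈B) , proj₁)
             (λ {a} a∈B → trans (deg⁻-outside A B a) (sym (deg⁻-L-B a∈B)))) ⟩
    (countᶠ (A ∩ᶠ B) f k + countᶠ (A ∖ᶠ B) f k) + countᶠ (L ∩ᶠ B) (deg⁻ L) k
      ≡⟨ cong (_+ countᶠ (L ∩ᶠ B) (deg⁻ L) k) (cong₂ _+_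
           (trans
             (countᶠ-cong (A ∩ᶠ B) interval f f k
               ((λ (a∈B , a∈A) → A∩B⇒K a∈A a∈B) , (λ a∈K → K⇒B a∈K , K⇒A a∈K)) (λ _ → refl))
             (countᶠ-shift interval f (deg⁻ interval) k 1 deg⁻-M₁-K))
           (countᶠ-cong (A ∖ᶠ B) (L ∖ᶠ B) f (deg⁻ L) k
             ((λ (a∉B , a∈A) → a∉B , proj₁ a∈A) , L∖B⇒A∖B) deg⁻-M₁-A∖B)) ⟩
    (d⁻ interval (k - + 1) + countᶠ (L ∖ᶠ B) (deg⁻ L) k) + countᶠ (L ∩ᶠ B) (deg⁻ L) k
      ≡⟨ trans (+-assoc (d⁻ interval (k - + 1)) _ _) (+-comm (d⁻ interval (k - + 1)) _) ⟩
    (countᶠ (L ∖ᶠ B) (deg⁻ L) k + countᶠ (L ∩ᶠ B) (deg⁻ L) k) + d⁻ interval (k - + 1)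
      ≡⟨ cong (_+ d⁻ interval (k - + 1))
           (trans (countᶠ-partition L B (deg⁻ L) k) (+-comm (countᶠ (L ∩ᶠ B) (deg⁻ L) k) _)) ⟨
    d⁻ L k + d⁻ interval (k - + 1) ∎
    where
    open ≡-Reasoning
    f : Subset n → ℕ
    f = deg⁻ M₁ ∘ (inside ∷_)

    L∖B⇒A∖B : Mem (L ∖ᶠ B) a → Mem (A ∖ᶠ B) a
    L∖B⇒A∖B (a∉B , a∈L) with L⇒A⊎B a∈L
    ... | inj₁ a∈A = a∉B , a∈A
    ... | inj₂ a∈B = contradiction a∈B a∉B

theorem5 : ∀ {n : ℕ} (P : FinPoset n) (K : Cutting P) (k : ℤ) →
    (d (P ⊞⊞ K) k ≡ d (P ⊞ K) k + d (Cutting.interval K) (k - + 2)) ×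
    (d⁻ (P ⊞ K) k ≡ d⁻ (𝓕 P) k + d⁻ (Cutting.interval K) (k - + 1))
theorem5 P K k = d-⊞⊞ P K k , d⁻-⊞ P K k
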